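{- Let $\mathcal{L}$ be a list of $n$ elements, let $1\le r\le n$, and let $\mathcal{O}=\{o_1,\ldots,o_p\}$ be an order set for $\mathcal{L}$. Run the algorithm (build $CountArray$ from $\mathcal{L}$ and $\mathcal{O}$, then call $\mathrm{APR}(1)$). Then the algorithm generates all $r$-permutations of $\mathcal{L}$, i.e. every $r$-permutation of $\mathcal{L}$ is printed.
   Context: A list is a finite collection of elements, possibly with repetitions; a set has no repetitions. The input consists of: a list $\mathcal{L}=\{l_1,\ldots,l_n\}$ containing exactly $p\le n$ distinct elements; an integer $r$ with $1\le r\le n$; and an order set $\mathcal{O}=\{o_1,\ldots,o_p\}$, which is the sequence of the $p$ distinct elements of $\mathcal{L}$, each listed once, in some chosen sequence. For an element $e$ of $\mathcal{L}$, $\mathcal{I}_{\mathcal{O}}(e)$ is the index $x$ with $o_x=e$. An $r$-permutation of $\mathcal{L}$ is an arrangement, in any order, of exactly $r$ elements of the list $\mathcal{L}$, viewed as a sequence of length $r$ of values (each value used at most as many times as it occurs in $\mathcal{L}$). The algorithm. Stage 1: build an integer array $CountArray[1\ldots p]$, initialised to $0$; for $i=1,\ldots,n$, increase $CountArray[\mathcal{I}_{\mathcal{O}}(l_i)]$ by $1$. Thus $CountArray[i]$ is the number of occurrences of $o_i$ in $\mathcal{L}$. Stage 2: call $\mathrm{APR}(1)$, where $\mathrm{APR}(index)$ is the following recursive procedure, with global data $CountArray$, $\mathcal{O}$, $r$, $p$ and an output array $\mathcal{R}$, and with $index$ and the loop variable $i$ local to each call. If $index>r$: print $\mathcal{R}[1,\ldots,r]$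 and return. Otherwise, for $i=1,2,\ldots,p$ in this order: if $CountArray[i]\ge 1$, then perform successively $\mathcal{R}[index]\gets o_i$; $CountArray[i]\gets CountArray[i]-1$; call $\mathrm{APR}(index+1)$; $CountArray[i]\gets CountArray[i]+1$. -}

module Defs where

open import Data.Bool.Base using (if_then_else_)
open import Data.Fin.Base using (Fin; fromℕ<)
open import Data.List.Base as List using (List; []; _∷ʳ_)
open import Data.Nat.Base using (ℕ; zero; suc; pred; _<_; _∸_)
open import Data.Nat.Induction using (Acc; acc; <-wellFounded)
open import Data.Nat.Properties using (_≤?_; _<?_; ∸-monoʳ-<; n<1+n)
open import Data.Product.Base using (∃-syntax; _×_)
open import Data.Vec.Base using (Vec; lookup; updateAt; replicate; _[_]≔_)
open import Data.Vec.Membership.Propositional using (_∈_)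
open import Data.Vec.Membership.Propositional.Properties using (∈-lookup)
open import Data.Vec.Relation.Unary.Any using (index)
open import Data.Vec.Relation.Unary.Unique.Propositional using (Unique)
open import Function.Base using (_∘_)
open import Function.Definitions using (Injective)
open import Relation.Binary.PropositionalEquality.Core using (_≡_)
open import Relation.Nullary.Decidable.Core using (does; yes; no)

-- All array positions are numbered from 0.

record IsOrderSet {a} {A : Set a} {n p} (L : Vec A n) (O : Vec A p) : Set a where
  field
    distinct : Unique O
    sound    : ∀ {e} → e ∈ O → e ∈ L
    complete : ∀ {e} → e ∈ L → e ∈ O

  -- The position x with lookup O x ≡ e.  Since O has no repetitions, it does
  -- not depend on the membership proof.
  𝓘 : ∀ {e} → e ∈ L → Fin p
  𝓘 = index ∘ complete

-- An arrangement of r elements of the list: r pairwise different positions of L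
-- are chosen, in some order, so a value is used at most as often as it occurs.
IsRPermutation : ∀ {a} {A : Set a} {n r} → Vec A n → Vec A r → Set a
IsRPermutation {n = n} {r} L xs =
  ∃[ f ] Injective {A = Fin r} {B = Fin n} _≡_ _≡_ f
       × (∀ j → lookup xs j ≡ lookup L (f j))

for : ∀ {s} {S : Set s} n → (Fin n → S → S) → S → S
for n body s = List.foldl (λ s i → body i s) s (List.allFin n)

countArray : ∀ {a} {A : Set a} {n p} (L : Vec A n) (O : Vec A p) →
             IsOrderSet L O → Vec ℕ p
countArray {n = n} {p} L O order =
  for n (λ i count → updateAt count (𝓘 (∈-lookup i L)) suc) (replicate p 0)
  where open IsOrderSet order

-- The global data that APR modifies, with everything printed so far, in order.
record State {a} (A : Set a) (p r : ℕ) : Set a where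
  constructor mkState
  field
    count   : Vec ℕ p
    R       : Vec A r
    printed : List (Vec A r)

module _ {a} {A : Set a} {p : ℕ} (O : Vec A p) {r : ℕ} where

  print : State A p r → State A p r
  print (mkState count R printed) = mkState count R (printed ∷ʳ R)

  choose : Fin r → Fin p → State A p r → State A p r
  choose k i (mkState count R printed) =
    mkState (updateAt count i pred) (R [ k ]≔ lookup O i) printed

  restore : Fin p → State A p r → State A p r
  restore i (mkState count R printed) = mkState (updateAt count i suc) R printed

  -- The body of the loop of APR, with the recursive call as a parameter.
  loopBody : Fin r → (State A p r → State A p r) → Fin p → State A p r → State A p r
  loopBody k call i s =
    if does (1 ≤? lookup (State.count s) i)
    then restore i (call (choose k i s))
    else s

  -- The accessibility argument only serves termination.
  APR : (index : ℕ) → Acc _<_ (r ∸ index) → State A p r → State A p r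
  APR index (acc rec) s with index <? r
  ... | no  _       = print s
  ... | yes index<r =
    for p (loopBody (fromℕ< index<r)
                    (APR (suc index) (rec (∸-monoʳ-< (n<1+n index) index<r)))) s

-- The sequences printed by the whole algorithm.  R₀ is the (irrelevant) content
-- of the output array before the run.
algorithm : ∀ {a} {A : Set a} {n p r} (L : Vec A n) (O : Vec A p) →
            IsOrderSet L O → (R₀ : Vec A r) → List (Vec A r)
algorithm {r = r} L O order R₀ =
  State.printed (APR O 0 (<-wellFounded (r ∸ 0)) (mkState (countArray L O order) R₀ []))

{-# OPTIONS --safe #-}
-- A recursive call leaves the counts and the already filled part of R as it
-- found them, and never removes printed output.  So when the loop at index k
-- reaches the value wanted at position k, it is in the state in which the loop
-- started.  That value is available because the counts are always the tally of
-- a list of positions of L containing f k, f (k+1), …: choosing the value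
-- removes f k from this list, and injectivity of f keeps the later ones in it.
module Submission where

open import Defs
open import Data.Fin.Base using (Fin; toℕ; fromℕ<)
open import Data.Fin.Properties using (_≟_; toℕ<n; toℕ-fromℕ<; toℕ-injective)
open import Data.List.Base using (List; []; _∷_; _++_; allFin; foldl; foldr; reverse)
open import Data.List.Membership.Propositional using (_∈_)
open import Data.List.Membership.Propositional.Properties
  using (∈-∃++; ∈-++⁺ˡ; ∈-++⁺ʳ; ∈-++⁻; ∈-allFin)
open import Data.List.Properties using (foldl-++; reverse-foldr)
open import Data.List.Relation.Binary.Subset.Propositional using (_⊆_)
open import Data.List.Relation.Unary.Any using (here; there)
open import Data.List.Relation.Unary.Any.Properties using (reverse⁺)
open import Data.Nat.Base using (ℕ; suc; pred; _≤_; _<_; _∸_; z≤n; s≤s; s≤s⁻¹)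
open import Data.Nat.Induction using (Acc; acc; <-wellFounded)
open import Data.Nat.Properties
  using (_<?_; ∸-monoʳ-<; n<1+n; m<n⇒m<1+n; <⇒≤; <-irrefl; <-≤-trans; ≮⇒≥;
         ≤∧≢⇒<; ≤-reflexive)
open import Data.Product.Base using (_,_)
open import Data.Sum.Base using (inj₁; inj₂)
open import Data.Vec.Base using (Vec; lookup; updateAt; replicate)
open import Data.Vec.Membership.Propositional.Properties using (∈-lookup)
open import Data.Vec.Properties
  using (updateAt-updateAt-local; updateAt-id; updateAt-commutes; lookup∘updateAt; lookup∘update;
         lookup∘update′; tabulate∘lookup; tabulate-cong)
open import Data.Vec.Relation.Unary.Any.Properties using (lookup-index)
open import Function.Base using (id; _∘_)
open import Function.Definitions using (Injective)
open import Relation.Binary.PropositionalEquality.Core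
  using (_≡_; _≢_; refl; sym; trans; cong; subst)
open import Relation.Nullary.Decidable using (yes; no)
open import Relation.Nullary.Negation using (contradiction)

-- The hypothesis concerns only the entry at `i`, because `suc ∘ pred` is the identity on positive
-- numbers alone.
updateAt-cancel : ∀ {b} {B : Set b} {p} (v : Vec B p) i {h k : B → B} →
                  h (k (lookup v i)) ≡ lookup v i →
                  updateAt (updateAt v i k) i h ≡ v
updateAt-cancel v i eq =
  trans (updateAt-updateAt-local i {h = id} v eq) (updateAt-id i v)

lookup-injective : ∀ {b} {B : Set b} {p} (v w : Vec B p) →
                   (∀ i → lookup v i ≡ lookup w i) → v ≡ w
lookup-injective v w eq =
  trans (sym (tabulate∘lookup v)) (trans (tabulate-cong eq) (tabulate∘lookup w))

module _ {n p : ℕ} (g : Fin n → Fin p) where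

  increment : Fin n → Vec ℕ p → Vec ℕ p
  increment i v = updateAt v (g i) suc

  tally : List (Fin n) → Vec ℕ p
  tally = foldr increment (replicate p 0)

  increment-comm : ∀ i j v → increment i (increment j v) ≡ increment j (increment i v)
  increment-comm i j v with g i ≟ g j
  ... | yes gi≡gj rewrite gi≡gj = refl
  ... | no  gi≢gj = updateAt-commutes (g i) (g j) gi≢gj v

  -- Increments commute, so the one for `x` can be pulled out past those for `us`. This lets a
  -- position be removed from a tally wherever it stands in the list.
  tally-shift : ∀ us x vs → tally (us ++ x ∷ vs) ≡ increment x (tally (us ++ vs))
  tally-shift []       x vs = refl
  tally-shift (u ∷ us) x vs =
    trans (cong (increment u) (tally-shift us x vs)) (increment-comm u x (tally (us ++ vs)))

module _ {a} {A : Set a} {p r : ℕ} where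

  open State

  -- Backtracking does not undo writes to `R`, so nothing is claimed about its entries from `k` on.
  record Preserves (k : ℕ) (s t : State A p r) : Set a where
    constructor preserves
    field
      count-≡   : count t ≡ count s
      R-≡       : ∀ j → toℕ j < k → lookup (R t) j ≡ lookup (R s) j
      printed-⊆ : printed s ⊆ printed t

  open Preserves

  Preserves-refl : ∀ {k s} → Preserves k s s
  Preserves-refl = preserves refl (λ _ _ → refl) id

  Preserves-trans : ∀ {k s t u} → Preserves k s t → Preserves k t u → Preserves k s u
  Preserves-trans P Q = preserves
    (trans (count-≡ Q) (count-≡ P))
    (λ j j<k → trans (R-≡ Q j j<k) (R-≡ P j j<k))
    (printed-⊆ Q ∘ printed-⊆ P)

  foldl-preserves : ∀ {b} {B : Set b} {k} (body : B → State A p r → State A p r) →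
                    (∀ i s → Preserves k s (body i s)) →
                    ∀ is s → Preserves k s (foldl (λ s i → body i s) s is)
  foldl-preserves body pres []       s = Preserves-refl
  foldl-preserves body pres (i ∷ is) s =
    Preserves-trans (pres i s) (foldl-preserves body pres is (body i s))

  -- The iterations are split at `i`: those before it lead to some `t` with `Preserves k s t`, those
  -- after it keep what has been printed. So only iteration `i` has to print `x`, but from every
  -- such `t`.
  for-prints : ∀ {m k} {body : Fin m → State A p r → State A p r} {x} →
               (∀ i s → Preserves k s (body i s)) →
               ∀ i s → (∀ t → Preserves k s t → x ∈ printed (body i t)) →
               x ∈ printed (for m body s)
  for-prints {body = body} {x} pres i s prints with ∈-∃++ (∈-allFin i)
  ... | is , js , allFin≡ rewrite allFin≡ | foldl-++ (λ s i → body i s) s is (i ∷ js) =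
    printed-⊆ (foldl-preserves body pres js _) (prints _ (foldl-preserves body pres is s))

  module _ (O : Vec A p) where

    -- Outside `call`, `R` is written only at position `k`, just beyond the protected entries. The
    -- count is decremented only when positive, so the later increment restores it exactly.
    loopBody-preserves : ∀ {k} (k<r : k < r) (call : State A p r → State A p r) →
                         (∀ s → Preserves (suc k) s (call s)) →
                         ∀ i s → Preserves k s (loopBody O (fromℕ< k<r) call i s)
    loopBody-preserves {k} k<r call pres i s with lookup (count s) i in c≡
    ... | 0     = Preserves-refl
    ... | suc _ = preserves
      (trans (cong (λ v → updateAt v i suc) (count-≡ P))
             (updateAt-cancel (count s) i (trans (cong (suc ∘ pred) c≡) (sym c≡))))
      (λ j j<k → trans (R-≡ P j (m<n⇒m<1+n j<k)) (lookup∘update′ (j≢k j j<k) (R s) _))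
      (printed-⊆ P)
      where
      P = pres (choose O (fromℕ< k<r) i s)
      j≢k : ∀ j → toℕ j < k → j ≢ fromℕ< k<r
      j≢k j j<k refl = <-irrefl (toℕ-fromℕ< k<r) j<k

    APR-preserves : ∀ k (ac : Acc _<_ (r ∸ k)) s → Preserves k s (APR O k ac s)
    APR-preserves k (acc rec) s with k <? r
    ... | no  _   = preserves refl (λ _ _ → refl) ∈-++⁺ˡ
    ... | yes k<r = foldl-preserves _
      (loopBody-preserves k<r _ (APR-preserves (suc k) (rec (∸-monoʳ-< (n<1+n k) k<r))))
      (allFin p) s

    -- The input list enters only through `g`, which stands for the map from its positions to the
    -- indices of their values in `O`.
    module _ {n : ℕ} (g : Fin n → Fin p) (xs : Vec A r) (f : Fin r → Fin n)
             (f-injective : Injective _≡_ _≡_ f)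
             (xs-f : ∀ j → lookup O (g (f j)) ≡ lookup xs j) where

      -- `available` is a ghost variable, absent from the program state. It holds positions rather
      -- than values, since equal values can be told apart only by position. It may contain
      -- positions that `f` never takes.
      record Completable (k : ℕ) (s : State A p r) : Set a where
        constructor completable
        field
          available : List (Fin n)
          count-≡   : count s ≡ tally g available
          suffix-∈  : ∀ j → k ≤ toℕ j → f j ∈ available
          prefix-≡  : ∀ j → toℕ j < k → lookup (R s) j ≡ lookup xs j

      Completable-resp : ∀ {k s t} → Preserves k s t → Completable k s → Completable k t
      Completable-resp P (completable ys c s∈ p≡) = completable ys
        (trans (count-≡ P) c) s∈ (λ j j<k → trans (R-≡ P j j<k) (p≡ j j<k))

      loopBody-prints : ∀ {k} (k<r : k < r) (call : State A p r → State A p r) →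
                        (∀ s → Completable (suc k) s → xs ∈ printed (call s)) →
                        ∀ s → Completable k s →
                        xs ∈ printed (loopBody O (fromℕ< k<r) call (g (f (fromℕ< k<r))) s)
      loopBody-prints {k} k<r call prints s (completable ys c≡ s∈ p≡)
        with ∈-∃++ (s∈ (fromℕ< k<r) (≤-reflexive (sym (toℕ-fromℕ< k<r))))
      -- Now `ys` is `us ++ f m ∷ vs`; dropping this one occurrence gives the available list for the
      -- recursive call.
      ... | us , vs , refl = result
        where
        m = fromℕ< k<r
        i = g (f m)
        rest = tally g (us ++ vs)

        count-s : count s ≡ updateAt rest i suc
        count-s = trans c≡ (tally-shift g us (f m) vs)

        1≤count : 1 ≤ lookup (count s) i
        1≤count = subst (1 ≤_)
          (sym (trans (cong (λ v → lookup v i) count-s) (lookup∘updateAt i rest)))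
          (s≤s z≤n)

        suffix : ∀ j → suc k ≤ toℕ j → f j ∈ us ++ vs
        suffix j k<j with ∈-++⁻ us (s∈ j (<⇒≤ k<j))
        ... | inj₁ ∈us         = ∈-++⁺ˡ ∈us
        ... | inj₂ (there ∈vs) = ∈-++⁺ʳ us ∈vs
        ... | inj₂ (here fj≡fm) =
          contradiction k<j (<-irrefl (sym (trans (cong toℕ (f-injective fj≡fm)) (toℕ-fromℕ< k<r))))

        prefix : ∀ j → toℕ j < suc k → lookup (R (choose O m i s)) j ≡ lookup xs j
        prefix j j<1+k with j ≟ m
        ... | yes refl = trans (lookup∘update m (R s) _) (xs-f m)
        ... | no  j≢m  = trans (lookup∘update′ j≢m (R s) _)
          (p≡ j (≤∧≢⇒< (s≤s⁻¹ j<1+k)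
            (λ j≡k → j≢m (toℕ-injective (trans j≡k (sym (toℕ-fromℕ< k<r)))))))

        result : xs ∈ printed (loopBody O m call i s)
        -- Abstracting the count together with its bound excludes zero and lets the test in
        -- `loopBody` reduce to its true branch.
        result with lookup (count s) i | 1≤count
        ... | suc _ | _ = prints (choose O m i s) (completable (us ++ vs)
          (trans (cong (λ v → updateAt v i pred) count-s) (updateAt-cancel rest i refl))
          suffix prefix)

      APR-prints : ∀ k (ac : Acc _<_ (r ∸ k)) s → Completable k s →
                   xs ∈ printed (APR O k ac s)
      APR-prints k (acc rec) s C with k <? r
      -- Here `r ≤ k`, so the prefix known to agree with `xs` is all of `R s`.
      ... | no  k≮r = ∈-++⁺ʳ (printed s) (here (lookup-injective xs (R s)
        (λ j → sym (Completable.prefix-≡ C j (<-≤-trans (toℕ<n j) (≮⇒≥ k≮r))))))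
      ... | yes k<r =
        let smaller = rec (∸-monoʳ-< (n<1+n k) k<r) in
        for-prints (loopBody-preserves k<r _ (APR-preserves (suc k) smaller))
          (g (f (fromℕ< k<r))) s
          (λ t P → loopBody-prints k<r (APR O (suc k) smaller) (APR-prints (suc k) smaller) t
            (Completable-resp P C))

theorem6 : ∀ {a} {A : Set a} {n p r : ℕ} (L : Vec A n) (O : Vec A p) (order : IsOrderSet L O) →
    1 ≤ r → r ≤ n → (R₀ : Vec A r) →
    (xs : Vec A r) → IsRPermutation L xs → xs ∈ algorithm L O order R₀
theorem6 {n = n} {p} {r} L O order _ _ R₀ xs (f , f-injective , xs≡L∘f) =
  APR-prints O g xs f f-injective
    -- `lookup-index` says that the index found by `complete` really holds the element of `L` at
    -- `f j`.
    (λ j → trans (sym (lookup-index (complete (∈-lookup (f j) L)))) (sym (xs≡L∘f j)))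
    0 (<-wellFounded (r ∸ 0)) _
    -- Initially every position is available. The list is reversed because the counting loop is a
    -- left fold and `tally` a right fold.
    (completable (reverse (allFin n))
      (sym (reverse-foldr (increment g) (replicate p 0) (allFin n)))
      (λ j _ → reverse⁺ (∈-allFin (f j)))
      (λ _ ()))
  where
  open IsOrderSet order
  g : Fin n → Fin p
  g i = 𝓘 (∈-lookup i L)
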